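{- For every finite graph $G$, $\mathrm{stw}(G) \leq \mathrm{ctww}(G) - 1$. Consequently, $\mathrm{stw}(G) \leq 2(\mathrm{cw}(G) - 1)$, where $\mathrm{cw}(G)$ is the clique-width of $G$.
   Context: All graphs are finite and simple. A partition sequence of an $n$-vertex graph $G$ is a sequence $\mathcal P_n,\dots,\mathcal P_1$ of partitions of $V(G)$ such that $\mathcal P_n$ is the partition into singletons, $\mathcal P_1=\{V(G)\}$, and for each $i<n$, $\mathcal P_i$ is obtained from $\mathcal P_{i+1}$ by merging two parts into their union. Two distinct parts $X,Y$ of a partition are inhomogeneous if there are $u,u'\in X$, $v,v'\in Y$ with $uv\in E(G)$ and $u'v'\notin E(G)$. The red graph $\mathcal R(\mathcal P)$ of a partition $\mathcal P$ has vertex set $\mathcal P$ and an edge between any two inhomogeneous parts. The component twin-width $\mathrm{ctww}(G)$ is the minimum, over all partition sequences of $G$, of the maximum over $i$ of the largest number of vertices (parts) of a connected component of $\mathcal R(\mathcal P_i)$. An ordered graph $(G,\prec)$ is a graph with a strict total order $\prec$ on $V(G)$. For $X\subseteq V(G)$, its span is $\langle X\rangle=\{v : \min X \preceq v\preceq \max X\}$. Two sets $X,Y\subseteq V(G)$ conflict if $\langle X\rangle\cap\langle Y\rangle\neq\emptyset$. For a partition $\mathcal P$ of $V(G)$ and $X\in\mathcal P$, a part $Y\in\mathcal P\setminus\{X\}$ interferes with $X$ if $Y$ conflicts with the union of the parts in the closed neighborhood of $X$ in $\mathcal R(\mathcal P)$. The stretch of $X$ is the number of parts of $\mathcal P$ interfering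 with $X$, and the stretch of $\mathcal P$ is the maximum stretch of its parts. The stretch-width $\mathrm{stw}(G,\prec)$ is the minimum over all partition sequences $\mathcal P_n,\dots,\mathcal P_1$ of $G$ of $\max_i$ (stretch of $\mathcal P_i$), and $\mathrm{stw}(G)$ is the minimum of $\mathrm{stw}(G,\prec)$ over all total orders $\prec$ on $V(G)$. -}

module Defs where

open import Data.Nat using (ℕ; zero; suc; _+_; _*_; _∸_; _≤_; _<_)
open import Data.Fin using (Fin; toℕ; splitAt; _↑ˡ_; _↑ʳ_)
open import Data.Fin.Properties using (_≟_)
open import Data.Bool using (Bool; true; false; _∨_; _∧_; if_then_else_)
open import Data.Sum using (_⊎_; inj₁; inj₂)
open import Data.Product using (Σ; ∃; ∃-syntax; _×_; _,_)
open import Data.Empty using (⊥)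
open import Relation.Nullary using (¬_; does)
open import Relation.Binary.PropositionalEquality using (_≡_; _≢_)
open import Relation.Binary.Structures using (IsStrictTotalOrder)
open import Function.Definitions using (Injective)
open import Function.Bundles using (_↔_; Inverse)

record Graph : Set where
  field
    n     : ℕ
    adj   : Fin n → Fin n → Bool
    sym   : ∀ u v → adj u v ≡ adj v u
    irrefl : ∀ u → adj u u ≡ false

open Graph public

-- Partitions of Fin n, encoded by a labelling p : Fin n → Fin n.
-- The parts are the nonempty fibres of p (a part is named by its label).

Labelling : ℕ → Set
Labelling n = Fin n → Fin n

module _ {n : ℕ} (p : Labelling n) where

  IsPart : Fin n → Set
  IsPart a = ∃[ x ] p x ≡ a

  Same : Fin n → Fin n → Set
  Same u v = p u ≡ p v

MergeOf : {n : ℕ} → Labelling n → Labelling n → Set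
MergeOf {n} p' p =
  Σ (Fin n) λ u → Σ (Fin n) λ v →
    (¬ Same p u v) ×
    (∀ x y → (Same p' x y → (Same p x y ⊎ ((Same p x u × Same p y v) ⊎ (Same p x v × Same p y u))))
           × ((Same p x y ⊎ ((Same p x u × Same p y v) ⊎ (Same p x v × Same p y u))) → Same p' x y))

-- A partition sequence P_n, …, P_1 : index k : Fin n stands for P_{k+1}.
record PartitionSequence (n : ℕ) : Set where
  field
    P          : Fin n → Labelling n
    singletons : ∀ (k : Fin n) → suc (toℕ k) ≡ n → ∀ x y → Same (P k) x y → x ≡ y
    whole      : ∀ (k : Fin n) → toℕ k ≡ 0 → ∀ x y → Same (P k) x y
    merge      : ∀ (k k' : Fin n) → toℕ k' ≡ suc (toℕ k) → MergeOf (P k) (P k')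

open PartitionSequence public

module _ (G : Graph) (p : Labelling (n G)) where

  Edge : Fin (n G) → Fin (n G) → Set
  Edge u v = adj G u v ≡ true

  NonEdge : Fin (n G) → Fin (n G) → Set
  NonEdge u v = adj G u v ≡ false

  Red : Fin (n G) → Fin (n G) → Set
  Red a b = (a ≢ b) ×
    (Σ (Fin (n G)) λ u → Σ (Fin (n G)) λ u' → Σ (Fin (n G)) λ v → Σ (Fin (n G)) λ v' →
       (p u ≡ a) × (p u' ≡ a) × (p v ≡ b) × (p v' ≡ b) × Edge u v × NonEdge u' v')

  data RedReach (a : Fin (n G)) : Fin (n G) → Set where
    here : IsPart p a → RedReach a a
    step : ∀ {b c} → RedReach a b → Red b c → RedReach a c

  RedComponentsAtMost : ℕ → Set
  RedComponentsAtMost k =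
    ∀ (a : Fin (n G)) (f : Fin (suc k) → Fin (n G)) → Injective _≡_ _≡_ f →
      (∀ i → RedReach a (f i)) → ⊥

CtwwAtMost : Graph → ℕ → Set
CtwwAtMost G k = Σ (PartitionSequence (n G)) λ S →
  ∀ (i : Fin (n G)) → RedComponentsAtMost G (P S i) k

module _ (G : Graph) (_≺_ : Fin (n G) → Fin (n G) → Set) where

  _⪯_ : Fin (n G) → Fin (n G) → Set
  x ⪯ y = (x ≺ y) ⊎ (x ≡ y)

  -- v belongs to the span ⟨X⟩ of X (X given as a predicate):
  -- min X ⪯ v ⪯ max X, i.e. some element of X is ⪯ v and some is ⪰ v
  InSpan : (Fin (n G) → Set) → Fin (n G) → Set
  InSpan X v = (Σ (Fin (n G)) λ x → X x × (x ⪯ v)) × (Σ (Fin (n G)) λ y → X y × (v ⪯ y))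

  Conflict : (Fin (n G) → Set) → (Fin (n G) → Set) → Set
  Conflict X Y = Σ (Fin (n G)) λ v → InSpan X v × InSpan Y v

  module _ (p : Labelling (n G)) where

    PartSet : Fin (n G) → Fin (n G) → Set
    PartSet a x = p x ≡ a

    ClosedNbhdUnion : Fin (n G) → Fin (n G) → Set
    ClosedNbhdUnion a x = (p x ≡ a) ⊎ Red G p a (p x)

    Interferes : Fin (n G) → Fin (n G) → Set
    Interferes a b = IsPart p b × (b ≢ a) × Conflict (PartSet b) (ClosedNbhdUnion a)

    StretchOfPartAtMost : Fin (n G) → ℕ → Set
    StretchOfPartAtMost a s =
      ∀ (f : Fin (suc s) → Fin (n G)) → Injective _≡_ _≡_ f →
        (∀ i → Interferes a (f i)) → ⊥

    StretchAtMost : ℕ → Set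
    StretchAtMost s = ∀ a → IsPart p a → StretchOfPartAtMost a s

OrderedStwAtMost : (G : Graph) → (Fin (n G) → Fin (n G) → Set) → ℕ → Set
OrderedStwAtMost G _≺_ s = Σ (PartitionSequence (n G)) λ S →
  ∀ (i : Fin (n G)) → StretchAtMost G _≺_ (P S i) s

StwAtMost : Graph → ℕ → Set₁
StwAtMost G s = Σ (Fin (n G) → Fin (n G) → Set) λ _≺_ →
  IsStrictTotalOrder _≡_ _≺_ × OrderedStwAtMost G _≺_ s

data Expr (k : ℕ) : ℕ → Set where
  vertex  : Fin k → Expr k 1
  union   : ∀ {m m'} → Expr k m → Expr k m' → Expr k (m + m')
  relabel : ∀ {m} → Fin k → Fin k → Expr k m → Expr k m
  join    : ∀ {m} → (i j : Fin k) → i ≢ j → Expr k m → Expr k m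

eqb : ∀ {k} → Fin k → Fin k → Bool
eqb i j = does (i ≟ j)

label : ∀ {k m} → Expr k m → Fin m → Fin k
label (vertex i) _ = i
label (union {m} e e') x with splitAt m x
... | inj₁ y = label e y
... | inj₂ y = label e' y
label (relabel i j e) x = if eqb (label e x) i then j else label e x
label (join i j _ e) x = label e x

eadj : ∀ {k m} → Expr k m → Fin m → Fin m → Bool
eadj (vertex i) _ _ = false
eadj (union {m} e e') x y with splitAt m x | splitAt m y
... | inj₁ a | inj₁ b = eadj e a b
... | inj₂ a | inj₂ b = eadj e' a b
... | inj₁ _ | inj₂ _ = false
... | inj₂ _ | inj₁ _ = false
eadj (relabel i j e) x y = eadj e x y
eadj (join i j _ e) x y =
  eadj e x y ∨ ((eqb (label e x) i ∧ eqb (label e y) j) ∨ (eqb (label e x) j ∧ eqb (label e y) i))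

CwAtMost : Graph → ℕ → Set
CwAtMost G k = Σ (Expr k (n G)) λ e → Σ (Fin (n G) ↔ Fin (n G)) λ π →
  ∀ u v → adj G u v ≡ eadj e (Inverse.to π u) (Inverse.to π v)

{-# OPTIONS --safe #-}
module Submission where

-- Along a partition sequence the red components only grow, so the vertex sets of all
-- components at all times are laminar and some order makes each of them an interval (compare
-- lexicographically by component, coarsest partition first). Then the span of a closed red
-- neighbourhood stays within its component, and so does every part interfering with it.
--
-- For clique-width, merge the label classes of every subexpression, children first. Parts
-- of disjoint subexpressions refine label classes and are therefore homogeneous to each
-- other, so red components only join parts of a single subexpression. At a union there are
-- at most k + k label classes, with no red edge between the children before the first merge
-- across them, and at most 2k - 1 classes after it.

open import Defs
open import Data.Bool using (Bool; true; false; _∨_; _∧_; if_then_else_)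
open import Data.Bool.Properties using (∨-assoc; ∨-identityʳ) renaming (_≟_ to _≟ᵇ_)
open import Data.Fin
  using (Fin; zero; suc; toℕ; inject₁; splitAt; _↑ˡ_; _↑ʳ_; punchIn; punchOut; _<_; _≤_)
open import Data.Fin.Induction using (<-weakInduction-startingFrom)
open import Data.Fin.Properties
  using (_≟_; any?; toℕ-inject₁; toℕ≤pred[n]; pigeonhole;
         <-cmp; <-trans; <-irrefl; <-isStrictTotalOrder; ≤-antisym;
         punchOut-injective; punchOut-punchIn; punchOut-cong; punchInᵢ≢i;
         splitAt-↑ˡ; splitAt-↑ʳ; splitAt⁻¹-↑ˡ; splitAt⁻¹-↑ʳ; ↑ˡ-injective; ↑ʳ-injective)
open import Data.List using (List; []; _∷_; foldr; tabulate; allFin; cartesianProduct)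
open import Data.List.Membership.Propositional using (_∈_)
open import Data.List.Membership.Propositional.Properties
  using (∈-tabulate⁺; ∈-allFin; ∈-cartesianProduct⁺)
open import Data.List.Relation.Unary.All as All using (_∷_)
open import Data.List.Relation.Unary.AllPairs using (AllPairs; _∷_)
open import Data.List.Relation.Unary.AllPairs.Properties using (tabulate⁺-<)
open import Data.List.Relation.Unary.Any using (here; there)
open import Data.Nat using (ℕ; zero; suc; _+_; _∸_; _*_; s≤s)
import Data.Nat as ℕ
import Data.Nat.Properties as ℕ
open import Data.Product using (Σ; ∃; _×_; _,_; proj₁; proj₂)
open import Data.Sum using (_⊎_; inj₁; inj₂; [_,_]′)
open import Data.Unit using (⊤; tt)
open import Function using (_∘_; id)
open import Function.Bundles using (Inverse)
open import Function.Definitions using (Injective; StrictlySurjective)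
open import Level using (0ℓ)
open import Relation.Binary
  using (Rel; Decidable; IsEquivalence; IsStrictTotalOrder; Tri; tri<; tri≈; tri>)
open import Relation.Binary.Consequences using (trans∧tri⇒resp)
open import Relation.Binary.PropositionalEquality as ≡
  using (_≡_; _≢_; refl; trans; cong; cong₂; subst; isEquivalence)
open import Relation.Nullary
  using (¬_; Dec; yes; no; ¬?; _×-dec_; _⊎-dec_; contradiction; decidable-stable)

-- Kernels, recolouring and components of a decidable relation.

_ker⊆_ : ∀ {A B C : Set} → (A → B) → (A → C) → Set
f ker⊆ g = ∀ x y → f x ≡ f y → g x ≡ g y

recolour : ∀ {A : Set} {k} → Fin k → Fin k → (A → Fin k) → A → Fin k
recolour a b c x with c x ≟ a
... | yes _ = b
... | no  _ = c x

recolour-ker : ∀ {A : Set} {k} (a b : Fin k) (c : A → Fin k) → c ker⊆ recolour a b c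
recolour-ker a b c x y eq with c x ≟ a | c y ≟ a
... | yes _   | yes _   = refl
... | yes x∈a | no  y∉a = contradiction (trans (≡.sym eq) x∈a) y∉a
... | no  x∉a | yes y∈a = contradiction (trans eq y∈a) x∉a
... | no  _   | no  _   = eq

recolour-merges : ∀ {A : Set} {k} (c : A → Fin k) u v →
  recolour (c u) (c v) c u ≡ recolour (c u) (c v) c v
recolour-merges c u v with c u ≟ c u | c v ≟ c u
... | yes _ | yes _ = refl
... | yes _ | no  _ = refl
... | no ¬p | _     = contradiction refl ¬p

module _ {n : ℕ} {R Q : Rel (Fin n) 0ℓ} (R? : Decidable R) (R⇒Q : ∀ {x y} → R x y → Q x y)
         (Q-equiv : IsEquivalence Q) where

  private module Q = IsEquivalence Q-equiv

  -- Two vertices that newly share a colour come from the old classes of `u` and `v`, so they are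
  -- linked through this pair.
  recolour-sound : ∀ {k} (c : Fin n → Fin k) u v → Q u v →
    (∀ x y → c x ≡ c y → Q x y) →
    ∀ x y → recolour (c u) (c v) c x ≡ recolour (c u) (c v) c y → Q x y
  recolour-sound c u v uv sound x y eq with c x ≟ c u | c y ≟ c u
  ... | yes x~u | yes y~u = sound x y (trans x~u (≡.sym y~u))
  ... | yes x~u | no  _   = Q.trans (sound x u x~u) (Q.trans uv (sound v y eq))
  ... | no  _   | yes y~u = Q.trans (sound x v eq) (Q.trans (Q.sym uv) (sound u y (≡.sym y~u)))
  ... | no  _   | no  _   = sound x y eq

  -- Union-find: starting from singletons, recolour once for each listed pair in `R`. The classes
  -- are caught between `R` and `Q`; when `Q` is reachability along `R`, they are the connected
  -- components.
  components-along : (es : List (Fin n × Fin n)) → Σ (Fin n → Fin n) λ c →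
    (∀ {x y} → (x , y) ∈ es → R x y → c x ≡ c y) × (∀ x y → c x ≡ c y → Q x y)
  components-along [] = id , (λ ()) , λ x y → Q.reflexive
  components-along ((u , v) ∷ es) with components-along es | R? u v
  ... | c , merges , sound | yes uRv =
    recolour (c u) (c v) c ,
    (λ where
      (here refl) _  → recolour-merges c u v
      (there e∈)  xy → recolour-ker (c u) (c v) c _ _ (merges e∈ xy)) ,
    recolour-sound c u v (R⇒Q uRv) sound
  ... | c , merges , sound | no ¬uRv =
    c ,
    (λ where
      (here refl) uRv → contradiction uRv ¬uRv
      (there e∈)  xy  → merges e∈ xy) ,
    sound

  components : Σ (Fin n → Fin n) λ c →
    (∀ {x y} → R x y → c x ≡ c y) × (∀ x y → c x ≡ c y → Q x y)
  components with components-along (cartesianProduct (allFin n) (allFin n))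
  ... | c , merges , sound =
    c , merges (∈-cartesianProduct⁺ (∈-allFin _) (∈-allFin _)) , sound

-- Orders with convex components

module _ {n k : ℕ} (c : Fin n → Fin k) (_≺_ : Rel (Fin n) 0ℓ) where

  LexBy : Rel (Fin n) 0ℓ
  LexBy x y = c x < c y ⊎ (c x ≡ c y × x ≺ y)

  LexBy-isStrictTotalOrder : IsStrictTotalOrder _≡_ _≺_ → IsStrictTotalOrder _≡_ LexBy
  LexBy-isStrictTotalOrder sto = record
    { isStrictPartialOrder = record
      { isEquivalence = isEquivalence
      ; irrefl        = λ where
          refl (inj₁ lt)       → <-irrefl refl lt
          refl (inj₂ (_ , lt)) → STO.irrefl refl lt
      ; trans         = lex-trans
      ; <-resp-≈      = trans∧tri⇒resp ≡.sym trans lex-trans lex-cmp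
      }
    ; compare = lex-cmp
    }
    where
    module STO = IsStrictTotalOrder sto

    lex-trans : ∀ {x y z} → LexBy x y → LexBy y z → LexBy x z
    lex-trans (inj₁ p)       (inj₁ q)       = inj₁ (<-trans p q)
    lex-trans {x}     (inj₁ p)       (inj₂ (q , _)) = inj₁ (subst (c x <_) q p)
    lex-trans {z = z} (inj₂ (p , _)) (inj₁ q)       = inj₁ (subst (_< c z) (≡.sym p) q)
    lex-trans (inj₂ (p , r)) (inj₂ (q , s)) = inj₂ (trans p q , STO.trans r s)

    lex-cmp : ∀ x y → Tri (LexBy x y) (x ≡ y) (LexBy y x)
    lex-cmp x y with <-cmp (c x) (c y)
    ... | tri< lt ne gt = tri< (inj₁ lt) (ne ∘ cong c)
      λ where (inj₁ p) → gt p ; (inj₂ (p , _)) → ne (≡.sym p)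
    ... | tri> lt ne gt = tri> (λ where (inj₁ p) → lt p ; (inj₂ (p , _)) → ne p)
      (ne ∘ cong c) (inj₁ gt)
    ... | tri≈ lt eq gt with STO.compare x y
    ...   | tri< lt′ ne gt′ = tri< (inj₂ (eq , lt′)) ne
      λ where (inj₁ p) → gt p ; (inj₂ (_ , p)) → gt′ p
    ...   | tri≈ lt′ x≡y gt′ = tri≈ (λ where (inj₁ p) → lt p ; (inj₂ (_ , p)) → lt′ p) x≡y
      λ where (inj₁ p) → gt p ; (inj₂ (_ , p)) → gt′ p
    ...   | tri> lt′ ne gt′ = tri> (λ where (inj₁ p) → lt p ; (inj₂ (_ , p)) → lt′ p) ne
      (inj₂ (≡.sym eq , gt′))

Lex : ∀ {n k} → List (Fin n → Fin k) → Rel (Fin n) 0ℓ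
Lex = foldr LexBy _<_

Lex-isStrictTotalOrder : ∀ {n k} (cs : List (Fin n → Fin k)) → IsStrictTotalOrder _≡_ (Lex cs)
Lex-isStrictTotalOrder []       = <-isStrictTotalOrder
Lex-isStrictTotalOrder (c ∷ cs) = LexBy-isStrictTotalOrder c (Lex cs) (Lex-isStrictTotalOrder cs)

Lex-head : ∀ {n k} {c : Fin n → Fin k} {cs x y} → Lex (c ∷ cs) x y → c x ≤ c y
Lex-head (inj₁ lt)       = ℕ.<⇒≤ lt
Lex-head (inj₂ (eq , _)) = ℕ.≤-reflexive (cong toℕ eq)

Lex-tail : ∀ {n k} {c : Fin n → Fin k} {cs x y} → c x ≡ c y → Lex (c ∷ cs) x y → Lex cs x y
Lex-tail eq (inj₁ lt)       = contradiction lt (<-irrefl eq)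
Lex-tail eq (inj₂ (_ , lt)) = lt

-- The head colour is monotone along the order, hence constant between two equal values. A later `d`
-- refines the head, so equal values of `d` put all three vertices in one head class, where the tail
-- of the list decides and induction applies.
Lex-convex : ∀ {n k} {cs : List (Fin n → Fin k)} {d x y z} →
  AllPairs (λ c c′ → c′ ker⊆ c) cs → d ∈ cs →
  Lex cs x y → Lex cs y z → d x ≡ d z → d x ≡ d y
Lex-convex {cs = c ∷ cs} {x = x} {y} {z} (_ ∷ _) (here refl) xy yz eq =
  ≤-antisym (Lex-head {cs = cs} xy) (subst (c y ≤_) (≡.sym eq) (Lex-head {cs = cs} yz))
Lex-convex {cs = c ∷ cs} {x = x} {y} {z} (finer ∷ nested) (there d∈) xy yz eq =
  Lex-convex nested d∈ (Lex-tail {cs = cs} cx≡cy xy) (Lex-tail {cs = cs} cy≡cz yz) eq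
  where
  cx≡cz = All.lookup finer d∈ x z eq
  cx≡cy = Lex-convex {cs = c ∷ cs} (finer ∷ nested) (here refl) xy yz cx≡cz
  cy≡cz = trans (≡.sym cx≡cy) cx≡cz

-- Red components and stretch

module _ (G : Graph) (p : Labelling (n G)) where

  Red-sym : ∀ {a b} → Red G p a b → Red G p b a
  Red-sym (a≢b , u , u′ , v , v′ , pu , pu′ , pv , pv′ , uv , u′v′) =
    a≢b ∘ ≡.sym , v , v′ , u , u′ , pv , pv′ , pu , pu′ ,
    trans (sym G v u) uv , trans (sym G v′ u′) u′v′

  Red? : Decidable (Red G p)
  Red? a b = ¬? (a ≟ b) ×-dec
    (any? λ u → any? λ u′ → any? λ v → any? λ v′ →
      (p u ≟ a) ×-dec (p u′ ≟ a) ×-dec (p v ≟ b) ×-dec (p v′ ≟ b) ×-dec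
      (adj G u v ≟ᵇ true) ×-dec (adj G u′ v′ ≟ᵇ false))

  RedReach-source : ∀ {a b} → RedReach G p a b → IsPart p a
  RedReach-source (here a∈)  = a∈
  RedReach-source (step r _) = RedReach-source r

  RedReach-trans : ∀ {a b c} → RedReach G p a b → RedReach G p b c → RedReach G p a c
  RedReach-trans r (here _)   = r
  RedReach-trans r (step s e) = step (RedReach-trans r s) e

  RedReach-sym : ∀ {a b} → RedReach G p a b → RedReach G p b a
  RedReach-sym (here a∈) = here a∈
  RedReach-sym (step r e@(_ , _ , _ , v , _ , _ , _ , pv , _)) =
    RedReach-trans (step (here (v , pv)) (Red-sym e)) (RedReach-sym r)

  -- Vertices are coloured rather than parts, so that components at different stages live on one set
  -- and can be compared.
  red-components : Σ (Fin (n G) → Fin (n G)) λ c →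
    (∀ {x y} → p x ≡ p y ⊎ Red G p (p x) (p y) → c x ≡ c y) ×
    (∀ x y → c x ≡ c y → RedReach G p (p x) (p y))
  red-components = components
    (λ x y → (p x ≟ p y) ⊎-dec Red? (p x) (p y))
    (λ {x} {y} → λ where
      (inj₁ eq) → subst (RedReach G p (p x)) eq (here (x , refl))
      (inj₂ e)  → step (here (x , refl)) e)
    (record
      { refl  = λ {x} → here (x , refl)
      ; sym   = RedReach-sym
      ; trans = RedReach-trans
      })

component : (G : Graph) → Labelling (n G) → Fin (n G) → Fin (n G)
component G p = proj₁ (red-components G p)

-- The witnesses of a red edge survive coarsening: the new parts around its ends coincide or are
-- again joined by a red edge. So the parts along a red walk stay in one component.
component-coarsens : (G : Graph) {p p′ : Labelling (n G)} → p ker⊆ p′ →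
  component G p ker⊆ component G p′
component-coarsens G {p} {p′} coarser x y eq =
  along (proj₂ (proj₂ (red-components G p)) x y eq) x y refl refl
  where
  joins : ∀ {x y} → p′ x ≡ p′ y ⊎ Red G p′ (p′ x) (p′ y) → component G p′ x ≡ component G p′ y
  joins = proj₁ (proj₂ (red-components G p′))

  along : ∀ {a b} → RedReach G p a b → ∀ u v → p u ≡ a → p v ≡ b →
    component G p′ u ≡ component G p′ v
  along (here _) u v pu pv = joins (inj₁ (coarser u v (trans pu (≡.sym pv))))
  along (step r (_ , w , w′ , z , z′ , pw , pw′ , pz , pz′ , wz , w′z′)) u v pu pv =
    trans (along r u w pu pw)
      (trans across (joins (inj₁ (coarser z v (trans pz (≡.sym pv))))))
    where
    across : component G p′ w ≡ component G p′ z
    across with p′ w ≟ p′ z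
    ... | yes same = joins (inj₁ same)
    ... | no  diff = joins (inj₂
      (diff , w , w′ , z , z′ , refl , coarser w′ w (trans pw′ (≡.sym pw)) , refl ,
       coarser z′ z (trans pz′ (≡.sym pz)) , wz , w′z′))

sequence-coarsens : ∀ {n} (S : PartitionSequence n) {i j : Fin n} → i ≤ j → P S j ker⊆ P S i
sequence-coarsens {suc n} S {i} = <-weakInduction-startingFrom
  (λ j → P S j ker⊆ P S i) (λ _ _ → id)
  (λ j ih x y eq → ih x y
    (proj₂ (proj₂ (proj₂ (proj₂ (merge S (inject₁ j) (suc j) (cong suc (≡.sym (toℕ-inject₁ j)))))) x y)
      (inj₁ eq)))

module _ (G : Graph) (_≺_ : Rel (Fin (n G)) 0ℓ) (p : Labelling (n G))
  (convex : ∀ {x y z} → x ≺ y → y ≺ z → component G p x ≡ component G p z →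
            component G p x ≡ component G p y) where

  span-component : ∀ {X : Fin (n G) → Set} {x v} →
    (∀ {y} → X y → component G p y ≡ component G p x) → InSpan G _≺_ X v →
    component G p v ≡ component G p x
  span-component X⊆ ((a , a∈ , inj₂ refl) , _)                  = X⊆ a∈
  span-component X⊆ ((a , a∈ , inj₁ a≺v) , (b , b∈ , inj₂ refl)) = X⊆ b∈
  span-component X⊆ ((a , a∈ , inj₁ a≺v) , (b , b∈ , inj₁ v≺b))  =
    trans (≡.sym (convex a≺v v≺b (trans (X⊆ a∈) (≡.sym (X⊆ b∈))))) (X⊆ a∈)

  -- By convexity, a vertex common to the two spans lies in the component of `a`, which contains the
  -- closed neighbourhood of `a`, and also in the component of `b`.
  interferes⇒reach : ∀ {a b} → IsPart p a → Interferes G _≺_ p a b → RedReach G p a b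
  interferes⇒reach (x , refl) ((y , refl) , _ , v , v∈b , v∈a) =
    proj₂ (proj₂ (red-components G p)) x y
      (trans (≡.sym (span-component nbhd v∈a))
             (span-component (λ z∈ → joins (inj₁ z∈)) v∈b))
    where
    joins : ∀ {x y} → p x ≡ p y ⊎ Red G p (p x) (p y) → component G p x ≡ component G p y
    joins = proj₁ (proj₂ (red-components G p))

    nbhd : ∀ {z} → ClosedNbhdUnion G _≺_ p (p x) z → component G p z ≡ component G p x
    nbhd (inj₁ z∈) = joins (inj₁ z∈)
    nbhd (inj₂ e)  = ≡.sym (joins (inj₂ e))

  -- The part `a` and those interfering with it are distinct members of one red component; `a`
  -- itself accounts for the one subtracted.
  stretch-bound : ∀ k → RedComponentsAtMost G p k → StretchAtMost G _≺_ p (k ∸ 1)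
  -- The component of `a` contains `a`, so a bound of zero is contradictory.
  stretch-bound zero    bound a a∈ f f-inj interf =
    bound a (λ _ → a) (λ { {zero} {zero} _ → refl }) (λ _ → here a∈)
  stretch-bound (suc k) bound a a∈ f f-inj interf = bound a g g-inj reach
    where
    g : Fin (suc (suc k)) → Fin (n G)
    g zero    = a
    g (suc i) = f i

    g-inj : Injective _≡_ _≡_ g
    g-inj {zero}  {zero}  _  = refl
    g-inj {zero}  {suc j} eq = contradiction (≡.sym eq) (proj₁ (proj₂ (interf j)))
    g-inj {suc i} {zero}  eq = contradiction eq (proj₁ (proj₂ (interf i)))
    g-inj {suc i} {suc j} eq = cong suc (f-inj eq)

    reach : ∀ i → RedReach G p a (g i)
    reach zero    = here a∈
    reach (suc i) = interferes⇒reach a∈ (interf i)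

-- The partition sequence is kept; one order, built from all its stages, serves every stage.
ctww⇒stw : (G : Graph) (k : ℕ) → CtwwAtMost G k → StwAtMost G (k ∸ 1)
ctww⇒stw G k (S , bound) =
  Lex comps , Lex-isStrictTotalOrder comps , S ,
  λ i → stretch-bound G (Lex comps) (P S i) (Lex-convex nested (∈-tabulate⁺ i)) k (bound i)
  where
  comps : List (Fin (n G) → Fin (n G))
  -- Index zero is the one-part partition, so the list runs from coarse to fine.
  comps = tabulate (component G ∘ P S)

  nested : AllPairs (λ c c′ → c′ ker⊆ c) comps
  nested = tabulate⁺-< (λ i<j → component-coarsens G (sequence-coarsens S (ℕ.<⇒≤ i<j)))

-- Merging two classes of a colouring.

Identified : ∀ {A B : Set} → (A → B) → A → A → A → A → Set
Identified q u v x y = q x ≡ q y ⊎ ((q x ≡ q u × q y ≡ q v) ⊎ (q x ≡ q v × q y ≡ q u))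

-- The equivalence in `MergeOf`, for maps with arbitrary codomains. In this form a merge inside one
-- child of a union is read off by restriction.
Merged : ∀ {A B C : Set} → (A → B) → A → A → (A → C) → Set
Merged q u v r = ∀ x y →
  (r x ≡ r y → Identified q u v x y) × (Identified q u v x y → r x ≡ r y)

Identified-map : ∀ {A B C : Set} {q : A → B} {r : A → C} {u v x y} → q ker⊆ r →
  Identified q u v x y → Identified r u v x y
Identified-map f (inj₁ xy)               = inj₁ (f _ _ xy)
Identified-map f (inj₂ (inj₁ (xu , yv))) = inj₂ (inj₁ (f _ _ xu , f _ _ yv))
Identified-map f (inj₂ (inj₂ (xv , yu))) = inj₂ (inj₂ (f _ _ xv , f _ _ yu))

Merged-coarsens : ∀ {A B C : Set} {q : A → B} {u v} {r : A → C} → Merged q u v r → q ker⊆ r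
Merged-coarsens m x y eq = proj₂ (m x y) (inj₁ eq)

Merged-refines : ∀ {A B C D : Set} {q : A → B} {u v} {r : A → C} {ℓ : A → D} →
  q ker⊆ ℓ → ℓ u ≡ ℓ v → Merged q u v r → r ker⊆ ℓ
Merged-refines {u = u} {v} q⊆ℓ uv m x y eq with proj₁ (m x y) eq
... | inj₁ xy               = q⊆ℓ x y xy
... | inj₂ (inj₁ (xu , yv)) = trans (q⊆ℓ x u xu) (trans uv (≡.sym (q⊆ℓ y v yv)))
... | inj₂ (inj₂ (xv , yu)) = trans (q⊆ℓ x v xv) (trans (≡.sym uv) (≡.sym (q⊆ℓ y u yu)))

ker⊆? : ∀ {m k K} (ℓ : Fin m → Fin k) (q : Fin m → Fin K) →
  ℓ ker⊆ q ⊎ (∃ λ u → ∃ λ v → ℓ u ≡ ℓ v × q u ≢ q v)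
ker⊆? ℓ q with any? (λ u → any? λ v → (ℓ u ≟ ℓ v) ×-dec ¬? (q u ≟ q v))
... | yes split = inj₂ split
... | no ¬split = inj₁ λ x y eq →
  decidable-stable (q x ≟ q y) (λ ne → ¬split (x , y , eq , ne))

-- Partition sequences by successive merges

-- The colour `a` is deleted from the codomain and its class joins that of `b`. One colour is lost
-- per merge, so for surjective colourings the codomain counts the parts.
contract : ∀ {K} {a b : Fin (suc (suc K))} → a ≢ b → Fin (suc (suc K)) → Fin (suc K)
contract {a = a} a≢b x with a ≟ x
... | yes _  = punchOut a≢b
... | no a≢x = punchOut a≢x

contract-surjective : ∀ {K} {a b : Fin (suc (suc K))} (a≢b : a ≢ b) →
  StrictlySurjective _≡_ (contract a≢b)
contract-surjective {a = a} a≢b y = punchIn a y , eq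
  where
  eq : contract a≢b (punchIn a y) ≡ y
  eq with a ≟ punchIn a y
  ... | yes a≡ = contradiction (≡.sym a≡) (punchInᵢ≢i a y)
  ... | no a≢  = trans (punchOut-cong a refl) (punchOut-punchIn a)

contract-merges : ∀ {A : Set} {K} (q : A → Fin (suc (suc K))) {u v} (u≢v : q u ≢ q v) →
  Merged q u v (contract u≢v ∘ q)
contract-merges q {u} {v} u≢v x y with q u ≟ q x | q u ≟ q y
... | yes ux | yes uy = (λ _ → inj₁ (trans (≡.sym ux) uy)) , λ _ → refl
... | yes ux | no u≢y =
  (λ eq → inj₂ (inj₁ (≡.sym ux , ≡.sym (punchOut-injective u≢v u≢y eq)))) , λ where
  (inj₁ xy)              → contradiction (trans ux xy) u≢y
  (inj₂ (inj₁ (_ , yv))) → punchOut-cong (q u) (≡.sym yv)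
  (inj₂ (inj₂ (_ , yu))) → contradiction (≡.sym yu) u≢y
... | no u≢x | yes uy =
  (λ eq → inj₂ (inj₂ (punchOut-injective u≢x u≢v eq , ≡.sym uy))) , λ where
  (inj₁ xy)              → contradiction (trans uy (≡.sym xy)) u≢x
  (inj₂ (inj₁ (xu , _))) → contradiction (≡.sym xu) u≢x
  (inj₂ (inj₂ (xv , _))) → punchOut-cong (q u) xv
... | no u≢x | no u≢y =
  (λ eq → inj₁ (punchOut-injective u≢x u≢y eq)) , λ where
  (inj₁ xy)              → punchOut-cong (q u) xy
  (inj₂ (inj₁ (xu , _))) → contradiction (≡.sym xu) u≢x
  (inj₂ (inj₂ (_ , yu))) → contradiction (≡.sym yu) u≢y

-- `Good` is an invariant and `move` a strategy finding a merge that preserves it while at least two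
-- classes remain. Preservation is asked for every map realising the merge, whatever its colours.
module Greedy {n : ℕ} (Good : ∀ {K} → (Fin n → Fin K) → Set)
  (move : ∀ {K} (q : Fin n → Fin (suc (suc K))) → StrictlySurjective _≡_ q → Good q →
    ∃ λ u → ∃ λ v → q u ≢ q v × (∀ {K′} (r : Fin n → Fin K′) → Merged q u v r → Good r))
  where

  record State (K : ℕ) : Set where
    field
      class      : Fin n → Fin (suc K)
      surjective : StrictlySurjective _≡_ class
      good       : Good class

    -- A `Labelling` takes values in `Fin n`, so each class is named by a chosen vertex in it.
    name : Labelling n
    name x = proj₁ (surjective (class x))

    class⊆name : class ker⊆ name
    class⊆name x y = cong (proj₁ ∘ surjective)

    name⊆class : name ker⊆ class
    name⊆class x y eq =
      trans (≡.sym (proj₂ (surjective (class x)))) (trans (cong class eq) (proj₂ (surjective (class y))))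

  open State

  next : ∀ {K} (s : State (suc K)) → Σ (State K) λ s′ → MergeOf (name s′) (name s)
  next {K} s with move (class s) (surjective s) (good s)
  ... | u , v , u≢v , keeps = s′ , u , v , u≢v ∘ name⊆class s u v , λ x y →
    (Identified-map (class⊆name s) ∘ proj₁ (merges x y) ∘ name⊆class s′ x y) ,
    (class⊆name s′ x y ∘ proj₂ (merges x y) ∘ Identified-map (name⊆class s))
    where
    merges : Merged (class s) u v (contract u≢v ∘ class s)
    merges = contract-merges (class s) u≢v

    s′ : State K
    s′ = record
      { class      = contract u≢v ∘ class s
      ; surjective = λ a → let b , eq = contract-surjective u≢v a ; x , eq′ = surjective s b in
                           x , trans (cong (contract u≢v) eq′) eq
      ; good       = keeps _ merges
      }

  trace : ∀ {K} → State K → ℕ → Labelling n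
  trace         s zero    = name s
  -- Only one class is left, and the trace stays constant from here on.
  trace {zero}  s (suc d) = name s
  trace {suc K} s (suc d) = trace (proj₁ (next s)) d

  trace-realised : ∀ {K} (s : State K) d → Σ ℕ λ K′ → Σ (State K′) λ s′ → trace s d ≡ name s′
  trace-realised         s zero    = _ , s , refl
  trace-realised {zero}  s (suc d) = _ , s , refl
  trace-realised {suc K} s (suc d) = trace-realised (proj₁ (next s)) d

  trace-merges : ∀ {K} (s : State K) {d} → d ℕ.< K → MergeOf (trace s (suc d)) (trace s d)
  trace-merges {suc K} s {zero}  _         = proj₂ (next s)
  trace-merges {suc K} s {suc d} (s≤s d<K) = trace-merges (proj₁ (next s)) d<K

  trace-whole : ∀ {K} (s : State K) x y → trace s K x ≡ trace s K y
  trace-whole {zero}  s x y = class⊆name s x y (Fin1-unique (class s x) (class s y))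
    where
    Fin1-unique : (a b : Fin 1) → a ≡ b
    Fin1-unique zero zero = refl
  trace-whole {suc K} s     = trace-whole (proj₁ (next s))

-- Each stage `P S i` comes with a good colouring of the same kernel, from which cluster bounds can
-- be carried over.
greedy-sequence : ∀ {n} (Good : ∀ {K} → (Fin n → Fin K) → Set) → Good id →
  (∀ {K} (q : Fin n → Fin (suc (suc K))) → StrictlySurjective _≡_ q → Good q →
    ∃ λ u → ∃ λ v → q u ≢ q v × (∀ {K′} (r : Fin n → Fin K′) → Merged q u v r → Good r)) →
  Σ (PartitionSequence n) λ S → ∀ i → Σ ℕ λ K → Σ (Fin n → Fin K) λ q →
    Good q × q ker⊆ P S i × P S i ker⊆ q
greedy-sequence {zero}  Good good-id move = record
  { P = λ () ; singletons = λ () ; whole = λ () ; merge = λ () } , λ ()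
greedy-sequence {suc N} Good good-id move = record
  -- Index `k` stands for `k + 1` parts, reached from `N + 1` singletons by `N ∸ k` merges.
  { P          = λ k → trace start (N ∸ toℕ k)
  ; singletons = λ k eq x y same → name⊆class start x y
      (subst (λ d → trace start d x ≡ trace start d y)
        (trans (cong (N ∸_) (ℕ.suc-injective eq)) (ℕ.n∸n≡0 N)) same)
  ; whole      = λ k eq x y →
      subst (λ i → trace start (N ∸ i) x ≡ trace start (N ∸ i) y) (≡.sym eq) (trace-whole start x y)
  ; merge      = λ k k′ eq → subst (λ d → MergeOf (trace start d) (trace start (N ∸ toℕ k′)))
      (earlier k k′ eq) (trace-merges start (later k k′ eq))
  } , λ i → realise (trace-realised start (N ∸ toℕ i))
  where
  open Greedy Good move
  open State

  start : State N
  start = record { class = id ; surjective = λ x → x , refl ; good = good-id }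

  earlier : ∀ (k k′ : Fin (suc N)) → toℕ k′ ≡ suc (toℕ k) → suc (N ∸ toℕ k′) ≡ N ∸ toℕ k
  earlier k k′ eq = trans (≡.sym (ℕ.+-∸-assoc 1 (toℕ≤pred[n] k′))) (cong (suc N ∸_) eq)

  later : ∀ (k k′ : Fin (suc N)) → toℕ k′ ≡ suc (toℕ k) → N ∸ toℕ k′ ℕ.< N
  later k k′ eq = ℕ.≤-trans (ℕ.≤-reflexive (earlier k k′ eq)) (ℕ.m∸n≤m N (toℕ k))

  realise : ∀ {p : Labelling (suc N)} → (Σ ℕ λ K → Σ (State K) λ s → p ≡ name s) →
    Σ ℕ λ K → Σ (Fin (suc N) → Fin K) λ q → Good q × q ker⊆ p × p ker⊆ q
  realise (_ , s , refl) = _ , class s , good s , class⊆name s , name⊆class s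

-- Clique-width expressions

data Side (m m′ : ℕ) : Fin (m + m′) → Set where
  inˡ : ∀ a → Side m m′ (a ↑ˡ m′)
  inʳ : ∀ b → Side m m′ (m ↑ʳ b)

side : ∀ m {m′} x → Side m m′ x
side m {m′} x with splitAt m x in eq
... | inj₁ a = subst (Side m m′) (splitAt⁻¹-↑ˡ eq) (inˡ a)
... | inj₂ b = subst (Side m m′) (splitAt⁻¹-↑ʳ eq) (inʳ b)

∉↑ˡ⇒∈↑ʳ : ∀ {m m′ x} → ¬ (∃ λ a → a ↑ˡ m′ ≡ x) → ∃ λ b → m ↑ʳ b ≡ x
∉↑ˡ⇒∈↑ʳ {m} {x = x} x∉ with side m x
... | inˡ a = contradiction (a , refl) x∉
... | inʳ b = b , refl

∉↑ʳ⇒∈↑ˡ : ∀ {m m′ x} → ¬ (∃ λ b → m ↑ʳ b ≡ x) → ∃ λ a → a ↑ˡ m′ ≡ x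
∉↑ʳ⇒∈↑ˡ {m} {x = x} x∉ with side m x
... | inˡ a = a , refl
... | inʳ b = contradiction (b , refl) x∉

↑ˡ≢↑ʳ : ∀ {m m′} {a : Fin m} {b : Fin m′} → a ↑ˡ m′ ≢ m ↑ʳ b
↑ˡ≢↑ʳ {m} {m′} {a} {b} eq
  with () ← trans (≡.sym (splitAt-↑ˡ m a m′)) (trans (cong (splitAt m) eq) (splitAt-↑ʳ m m′ b))

module _ {k m m′ : ℕ} (e : Expr k m) (e′ : Expr k m′) where

  label-↑ˡ : ∀ a → label (union e e′) (a ↑ˡ m′) ≡ label e a
  label-↑ˡ a rewrite splitAt-↑ˡ m a m′ = refl

  label-↑ʳ : ∀ b → label (union e e′) (m ↑ʳ b) ≡ label e′ b
  label-↑ʳ b rewrite splitAt-↑ʳ m m′ b = refl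

  eadj-↑ˡ : ∀ a b → eadj (union e e′) (a ↑ˡ m′) (b ↑ˡ m′) ≡ eadj e a b
  eadj-↑ˡ a b rewrite splitAt-↑ˡ m a m′ | splitAt-↑ˡ m b m′ = refl

  eadj-↑ʳ : ∀ a b → eadj (union e e′) (m ↑ʳ a) (m ↑ʳ b) ≡ eadj e′ a b
  eadj-↑ʳ a b rewrite splitAt-↑ʳ m m′ a | splitAt-↑ʳ m m′ b = refl

  eadj-↑ˡ-↑ʳ : ∀ a b → eadj (union e e′) (a ↑ˡ m′) (m ↑ʳ b) ≡ false
  eadj-↑ˡ-↑ʳ a b rewrite splitAt-↑ˡ m a m′ | splitAt-↑ʳ m m′ b = refl

  eadj-↑ʳ-↑ˡ : ∀ a b → eadj (union e e′) (m ↑ʳ b) (a ↑ˡ m′) ≡ false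
  eadj-↑ʳ-↑ˡ a b rewrite splitAt-↑ˡ m a m′ | splitAt-↑ʳ m m′ b = refl

left : ∀ {m m′} {C : Set} → (Fin (m + m′) → C) → Fin m → C
left {m′ = m′} q a = q (a ↑ˡ m′)

right : ∀ m {m′} {C : Set} → (Fin (m + m′) → C) → Fin m′ → C
right m q b = q (m ↑ʳ b)

-- Classes of `q` may be unions of several label classes; the final phase, which merges everything
-- into one part, relies on this.
Complete : ∀ {k m K} → Expr k m → (Fin m → Fin K) → Set
Complete e q = label e ker⊆ q

-- The partitions met while the label classes of e are being merged, children first.
-- At a union the label classes of both children are completed before any class of one
-- is merged with a class of the other; the last clause requires that this has begun.
Admissible : ∀ {k m K} → Expr k m → (Fin m → Fin K) → Set
Admissible (vertex i)      q = ⊤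
Admissible (join i j _ e)  q = Admissible e q
Admissible (relabel i j e) q =
  Admissible e q ⊎ (Complete e q × q ker⊆ label (relabel i j e))
Admissible (union {m} {m′} e e′) q =
  (Admissible e (left q) × Admissible e′ (right m q) ×
   (∀ (a : Fin m) (b : Fin m′) → left q a ≢ right m q b)) ⊎
  (Complete e (left q) × Complete e′ (right m q) × q ker⊆ label (union e e′) ×
   ∃ λ (a : Fin m) → ∃ λ (b : Fin m′) → left q a ≡ right m q b)

relabelled : ∀ {k} → Fin k → Fin k → Fin k → Fin k
relabelled i j c = if eqb c i then j else c

-- Later operations see vertices only through their labels, so by this refinement they treat all
-- vertices of a class alike.
Admissible⇒refines : ∀ {k m K} (e : Expr k m) {q : Fin m → Fin K} →
  Admissible e q → q ker⊆ label e
Admissible⇒refines (vertex i)      _              x y _  = refl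
Admissible⇒refines (join i j _ e)  adm            = Admissible⇒refines e adm
Admissible⇒refines (relabel i j e) (inj₁ adm)     x y eq =
  cong (relabelled i j) (Admissible⇒refines e adm x y eq)
Admissible⇒refines (relabel i j e) (inj₂ (_ , r)) = r
Admissible⇒refines (union e e′) (inj₂ (_ , _ , r , _)) = r
Admissible⇒refines (union {m} e e′) (inj₁ (adm , adm′ , apart)) x y eq
  with side m x | side m y
... | inˡ a | inˡ b = trans (label-↑ˡ e e′ a)
  (trans (Admissible⇒refines e adm a b eq) (≡.sym (label-↑ˡ e e′ b)))
... | inˡ a | inʳ b = contradiction eq (apart a b)
... | inʳ a | inˡ b = contradiction (≡.sym eq) (apart b a)
... | inʳ a | inʳ b = trans (label-↑ʳ e e′ a)
  (trans (Admissible⇒refines e′ adm′ a b eq) (≡.sym (label-↑ʳ e e′ b)))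

Admissible-resp : ∀ {k m K L} (e : Expr k m) {q : Fin m → Fin K} {r : Fin m → Fin L} →
  q ker⊆ r → r ker⊆ q → Admissible e q → Admissible e r
Admissible-resp (vertex i)      f g _   = tt
Admissible-resp (join i j _ e)  f g adm = Admissible-resp e f g adm
Admissible-resp (relabel i j e) f g (inj₁ adm) = inj₁ (Admissible-resp e f g adm)
Admissible-resp (relabel i j e) f g (inj₂ (c , r)) =
  inj₂ ((λ x y → f x y ∘ c x y) , (λ x y → r x y ∘ g x y))
Admissible-resp (union e e′) f g (inj₁ (adm , adm′ , apart)) = inj₁
  ( Admissible-resp e (λ x y → f _ _) (λ x y → g _ _) adm
  , Admissible-resp e′ (λ x y → f _ _) (λ x y → g _ _) adm′
  , λ a b → apart a b ∘ g _ _)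
Admissible-resp (union e e′) f g (inj₂ (c , c′ , r , a , b , ab)) = inj₂
  ( (λ x y → f _ _ ∘ c x y) , (λ x y → f _ _ ∘ c′ x y) , (λ x y → r x y ∘ g x y)
  , a , b , f _ _ ab)

Admissible-injective : ∀ {k m K} (e : Expr k m) {q : Fin m → Fin K} →
  Injective _≡_ _≡_ q → Admissible e q
Admissible-injective (vertex i)      inj = tt
Admissible-injective (join i j _ e)  inj = Admissible-injective e inj
Admissible-injective (relabel i j e) inj = inj₁ (Admissible-injective e inj)
Admissible-injective (union {m} {m′} e e′) inj = inj₁
  ( Admissible-injective e (↑ˡ-injective m′ _ _ ∘ inj)
  , Admissible-injective e′ (↑ʳ-injective m _ _ ∘ inj)
  , λ a b → ↑ˡ≢↑ʳ ∘ inj)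

-- Finding the next admissible merge.

Mergeable : ∀ {k m K} → Expr k m → (Fin m → Fin K) → Set
Mergeable {m = m} e q = ∃ λ u → ∃ λ v → q u ≢ q v ×
  (∀ {L} (r : Fin m → Fin L) → Merged q u v r → Admissible e r)

-- Vertices avoiding both merged classes gain no new partners. This shields one child of a union
-- from merges in the other.
Merged-untouched : ∀ {A B C D : Set} {q : A → B} {u v} {r : A → C} (ι : D → A) →
  (∀ d → q (ι d) ≢ q u) → (∀ d → q (ι d) ≢ q v) → Merged q u v r →
  ∀ d y → r (ι d) ≡ r y → q (ι d) ≡ q y
Merged-untouched ι ≢u ≢v m d y eq with proj₁ (m (ι d) y) eq
... | inj₁ dy              = dy
... | inj₂ (inj₁ (du , _)) = contradiction du (≢u d)
... | inj₂ (inj₂ (dv , _)) = contradiction dv (≢v d)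

progress-relabel : ∀ {k m K} i j (e : Expr k m) {q : Fin m → Fin K} →
  Complete e q → q ker⊆ label (relabel i j e) →
  Complete (relabel i j e) q ⊎ Mergeable (relabel i j e) q
progress-relabel i j e {q} c r with ker⊆? (label (relabel i j e)) q
... | inj₁ c′ = inj₁ c′
... | inj₂ (u , v , uv , u≢v) = inj₂ (u , v , u≢v , λ _ merged →
  inj₂ ((λ x y → Merged-coarsens merged x y ∘ c x y) , Merged-refines r uv merged))

-- Once both children are complete, two distinct classes with the same label must lie in different
-- children. Merging them supplies the crossing pair that the last clause of `Admissible` demands.
progress-union : ∀ {k m m′ K} (e : Expr k m) (e′ : Expr k m′) {q : Fin (m + m′) → Fin K} →
  Complete e (left q) → Complete e′ (right m q) → q ker⊆ label (union e e′) →
  Complete (union e e′) q ⊎ Mergeable (union e e′) q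
progress-union {m = m} {m′} e e′ {q} c c′ refines with ker⊆? (label (union e e′)) q
... | inj₁ c″ = inj₁ c″
... | inj₂ (u , v , uv , u≢v) = inj₂ (u , v , u≢v , λ r merged → inj₂
  ( (λ x y → Merged-coarsens merged _ _ ∘ c x y)
  , (λ x y → Merged-coarsens merged _ _ ∘ c′ x y)
  , Merged-refines refines uv merged
  , meet u v uv u≢v r (proj₂ (merged u v) (inj₂ (inj₁ (refl , refl))))))
  where
  meet : ∀ u v → label (union e e′) u ≡ label (union e e′) v → q u ≢ q v →
    ∀ {L} (r : Fin _ → Fin L) → r u ≡ r v → ∃ λ (a : Fin m) → ∃ λ (b : Fin m′) → left r a ≡ right m r b
  meet u v uv u≢v r ruv with side m u | side m v
  ... | inˡ a | inʳ b = a , b , ruv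
  ... | inʳ b | inˡ a = a , b , ≡.sym ruv
  ... | inˡ a | inˡ b = contradiction
    (c a b (trans (≡.sym (label-↑ˡ e e′ a)) (trans uv (label-↑ˡ e e′ b)))) u≢v
  ... | inʳ a | inʳ b = contradiction
    (c′ a b (trans (≡.sym (label-↑ʳ e e′ a)) (trans uv (label-↑ʳ e e′ b)))) u≢v

-- The expression is worked off in post-order: first child, second child, then the node itself. A
-- join leaves labels alone and calls for no merge of its own.
progress : ∀ {k m K} (e : Expr k m) (q : Fin m → Fin K) → Admissible e q →
  Complete e q ⊎ Mergeable e q
progress (vertex i)      q _   = inj₁ λ { zero zero _ → refl }
progress (join i j _ e)  q adm = progress e q adm
progress (relabel i j e) q (inj₂ (c , r)) = progress-relabel i j e c r
progress (relabel i j e) q (inj₁ adm) with progress e q adm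
... | inj₁ c = progress-relabel i j e c (Admissible⇒refines (relabel i j e) (inj₁ adm))
... | inj₂ (u , v , u≢v , keeps) =
  inj₂ (u , v , u≢v , λ r merged → inj₁ (keeps r merged))
progress (union e e′) q (inj₂ (c , c′ , r , _)) = progress-union e e′ c c′ r
progress (union {m} {m′} e e′) q adm∪@(inj₁ (adm , adm′ , apart))
  with progress e (left q) adm
... | inj₂ (u , v , u≢v , keeps) =
  inj₂ (u ↑ˡ m′ , v ↑ˡ m′ , u≢v , λ r merged → inj₁
    ( keeps (left r) (λ x y → merged _ _)
    , Admissible-resp e′ (λ x y → Merged-coarsens merged _ _)
        (λ x y → untouched merged x (m ↑ʳ y)) adm′
    , λ a b eq → apart a b (≡.sym (untouched merged b (a ↑ˡ m′) (≡.sym eq)))))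
  where
  untouched : ∀ {L} {r : Fin _ → Fin L} → Merged q (u ↑ˡ m′) (v ↑ˡ m′) r →
    ∀ (b : Fin m′) y → right m r b ≡ r y → right m q b ≡ q y
  untouched = Merged-untouched (m ↑ʳ_) (λ b → apart u b ∘ ≡.sym) (λ b → apart v b ∘ ≡.sym)
... | inj₁ c with progress e′ (right m q) adm′
...   | inj₁ c′ = progress-union e e′ c c′ (Admissible⇒refines (union e e′) adm∪)
...   | inj₂ (u , v , u≢v , keeps) =
  inj₂ (m ↑ʳ u , m ↑ʳ v , u≢v , λ r merged → inj₁
    ( Admissible-resp e (λ x y → Merged-coarsens merged _ _)
        (λ x y → untouched merged x (y ↑ˡ m′)) adm
    , keeps (right m r) (λ x y → merged _ _)
    , λ a b eq → apart a b (untouched merged a (m ↑ʳ b) eq)))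
  where
  untouched : ∀ {L} {r : Fin _ → Fin L} → Merged q (m ↑ʳ u) (m ↑ʳ v) r →
    ∀ (a : Fin m) y → left r a ≡ r y → left q a ≡ q y
  untouched = Merged-untouched (_↑ˡ m′) (λ a → apart a u) (λ a → apart a v)

-- Clusters closed under red edges.

-- A union of parts containing x with no red edge to the outside, and at most s parts.
record Cluster {m K : ℕ} (α : Fin m → Fin m → Bool) (q : Fin m → Fin K)
  (s : ℕ) (x : Fin m) : Set where
  field
    inside      : Fin m → Bool
    x-inside    : inside x ≡ true
    saturated   : q ker⊆ inside
    homogeneous : ∀ {u u′ v v′} → inside u ≡ true → inside v ≡ false →
                  q u ≡ q u′ → q v ≡ q v′ → α u v ≡ α u′ v′
    code        : Fin m → Fin s
    code-inj    : ∀ {y z} → inside y ≡ true → inside z ≡ true → code y ≡ code z → q y ≡ q z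

open Cluster

-- When all parts together fit into `s` codes, the whole vertex set is a cluster, with nothing
-- outside it.
coded-cluster : ∀ {m K s} {α} {q : Fin m → Fin K} (c : Fin m → Fin s) → c ker⊆ q →
  ∀ x → Cluster α q s x
coded-cluster c inj x = record
  { inside = λ _ → true ; x-inside = refl ; saturated = λ _ _ _ → refl
  ; homogeneous = λ _ () ; code = c ; code-inj = λ _ _ → inj _ _ }

complete-cluster : ∀ {k m K} {α} (e : Expr k m) {q : Fin m → Fin K} (t : ℕ) → Complete e q →
  ∀ x → Cluster α q (k + t) x
complete-cluster e t c = coded-cluster ((_↑ˡ t) ∘ label e) (λ x y eq → c x y (↑ˡ-injective t _ _ eq))

Cluster-map : ∀ {m m′ K K′ s} {α : Fin m → Fin m → Bool} {α′ : Fin m′ → Fin m′ → Bool}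
  {q : Fin m → Fin K} {q′ : Fin m′ → Fin K′} (σ : Fin m′ → Fin m) →
  (∀ u v → α′ u v ≡ α (σ u) (σ v)) → q′ ker⊆ (q ∘ σ) → (q ∘ σ) ker⊆ q′ →
  ∀ {x} → Cluster α q s (σ x) → Cluster α′ q′ s x
Cluster-map σ α≡ f g C = record
  { inside      = inside C ∘ σ
  ; x-inside    = x-inside C
  ; saturated   = λ y z → saturated C _ _ ∘ f y z
  ; homogeneous = λ {u} {u′} {v} {v′} u∈ v∉ uu′ vv′ →
      trans (α≡ u v) (trans (homogeneous C u∈ v∉ (f _ _ uu′) (f _ _ vv′)) (≡.sym (α≡ u′ v′)))
  ; code        = code C ∘ σ
  ; code-inj    = λ {y} {z} y∈ z∈ eq → g y z (code-inj C y∈ z∈ eq)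
  }

-- Codes of the labels of the second child of a union: its class labelled l has
-- the code of the class of the first child that it has been merged with.
module _ {k : ℕ} (l : Fin (suc k)) where

  codeʳ : Fin (suc k) → Fin (suc k + k)
  codeʳ c with l ≟ c
  ... | yes _  = l ↑ˡ k
  ... | no l≢c = suc k ↑ʳ punchOut l≢c

  codeʳ-injective : ∀ {c d} → codeʳ c ≡ codeʳ d → c ≡ d
  codeʳ-injective {c} {d} eq with l ≟ c | l ≟ d
  ... | yes lc | yes ld = trans (≡.sym lc) ld
  ... | yes lc | no  _  = contradiction eq ↑ˡ≢↑ʳ
  ... | no  _  | yes ld = contradiction (≡.sym eq) ↑ˡ≢↑ʳ
  ... | no l≢c | no l≢d = punchOut-injective l≢c l≢d (↑ʳ-injective (suc k) _ _ eq)

  codeʳ≡↑ˡ : ∀ {c a} → a ↑ˡ k ≡ codeʳ c → a ≡ l × c ≡ l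
  codeʳ≡↑ˡ {c} eq with l ≟ c
  ... | yes lc = ↑ˡ-injective k _ _ eq , ≡.sym lc
  ... | no  _  = contradiction eq ↑ˡ≢↑ʳ

module _ {k m m′ K : ℕ} (e : Expr (suc k) m) (e′ : Expr (suc k) m′) {q : Fin (m + m′) → Fin K}
  (c : Complete e (left q)) (c′ : Complete e′ (right m q)) (refines : q ker⊆ label (union e e′))
  {a₀ : Fin m} {b₀ : Fin m′} (a₀b₀ : left q a₀ ≡ right m q b₀) where

  private
    label-eq : label e a₀ ≡ label e′ b₀
    label-eq = trans (≡.sym (label-↑ˡ e e′ a₀)) (trans (refines _ _ a₀b₀) (label-↑ʳ e e′ b₀))

    -- The only code used on both sides is that of the label of `a₀`. Both vertices then carry this
    -- label, and completeness links them through `a₀` and `b₀`.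
    crossing : ∀ {a : Fin m} {b : Fin m′} → label e a ↑ˡ k ≡ codeʳ (label e a₀) (label e′ b) →
      left q a ≡ right m q b
    crossing eq with codeʳ≡↑ˡ (label e a₀) eq
    ... | al , bl = trans (c _ _ al) (trans a₀b₀ (≡.sym (c′ _ _ (trans bl label-eq))))

  codeˢ : ∀ {x} → Side m m′ x → Fin (suc k + k)
  codeˢ (inˡ a) = label e a ↑ˡ k
  codeˢ (inʳ b) = codeʳ (label e a₀) (label e′ b)

  codeˢ-injective : ∀ {x y} (s : Side m m′ x) (t : Side m m′ y) → codeˢ s ≡ codeˢ t → q x ≡ q y
  codeˢ-injective (inˡ a) (inˡ b) eq = c a b (↑ˡ-injective k _ _ eq)
  codeˢ-injective (inˡ a) (inʳ b) eq = crossing eq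
  codeˢ-injective (inʳ b) (inˡ a) eq = ≡.sym (crossing (≡.sym eq))
  codeˢ-injective (inʳ a) (inʳ b) eq = c′ a b (codeʳ-injective (label e a₀) eq)

  -- Each child has at most `suc k` classes, and the class shared by `a₀` and `b₀` is counted once.
  union-cluster : ∀ {α} x → Cluster α q (suc k + k) x
  union-cluster = coded-cluster (codeˢ ∘ side m) (λ x y → codeˢ-injective (side m x) (side m y))

module _ {m M K s : ℕ} {α : Fin M → Fin M → Bool} {q : Fin M → Fin K}
  (ι : Fin m → Fin M) (ι-injective : Injective _≡_ _≡_ ι)
  (apart : ∀ a {y} → ¬ (∃ λ b → ι b ≡ y) → q (ι a) ≢ q y)
  (cross : ∀ {a a′ y y′} → ¬ (∃ λ b → ι b ≡ y) → ¬ (∃ λ b → ι b ≡ y′) →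
    q (ι a) ≡ q (ι a′) → q y ≡ q y′ → α (ι a) y ≡ α (ι a′) y′)
  where

  private
    image? : ∀ y → Dec (∃ λ b → ι b ≡ y)
    image? y = any? λ b → ι b ≟ y

    extend : ∀ {A : Set} → A → (Fin m → A) → ∀ {y} → Dec (∃ λ b → ι b ≡ y) → A
    extend default f (yes (b , _)) = f b
    extend default f (no _)        = default

  -- Everything off the image is declared outside: `apart` keeps the cluster a union of parts, and
  -- `cross` makes it homogeneous to the new vertices. These get the dummy code `c₀`, which is never
  -- compared.
  Cluster-extend : Fin s → ∀ {a} → Cluster (λ u v → α (ι u) (ι v)) (q ∘ ι) s a → Cluster α q s (ι a)
  Cluster-extend c₀ {a₀} C = record
    { inside      = inside⁺ ∘ image?
    ; x-inside    = x-inside⁺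
    ; saturated   = λ x y → saturated⁺ (image? x) (image? y)
    ; homogeneous = λ {u} {u′} {v} {v′} → homogeneous⁺ (image? u) (image? u′) (image? v) (image? v′)
    ; code        = extend c₀ (code C) ∘ image?
    ; code-inj    = λ {y} {z} → code-inj⁺ (image? y) (image? z)
    }
    where
    inside⁺ : ∀ {y} → Dec (∃ λ b → ι b ≡ y) → Bool
    inside⁺ = extend false (inside C)

    x-inside⁺ : inside⁺ (image? (ι a₀)) ≡ true
    x-inside⁺ with image? (ι a₀)
    ... | yes (b , eq) = trans (cong (inside C) (ι-injective eq)) (x-inside C)
    ... | no ∉image    = contradiction (a₀ , refl) ∉image

    saturated⁺ : ∀ {x y} (dx : Dec (∃ λ b → ι b ≡ x)) (dy : Dec (∃ λ b → ι b ≡ y)) →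
      q x ≡ q y → inside⁺ dx ≡ inside⁺ dy
    saturated⁺ (yes (a , refl)) (yes (b , refl)) eq = saturated C a b eq
    saturated⁺ (yes (a , refl)) (no y∉)          eq = contradiction eq (apart a y∉)
    saturated⁺ (no x∉)          (yes (b , refl)) eq = contradiction (≡.sym eq) (apart b x∉)
    saturated⁺ (no _)           (no _)           eq = refl

    homogeneous⁺ : ∀ {u u′ v v′} (du : Dec (∃ λ b → ι b ≡ u)) (du′ : Dec (∃ λ b → ι b ≡ u′))
      (dv : Dec (∃ λ b → ι b ≡ v)) (dv′ : Dec (∃ λ b → ι b ≡ v′)) →
      inside⁺ du ≡ true → inside⁺ dv ≡ false → q u ≡ q u′ → q v ≡ q v′ → α u v ≡ α u′ v′
    homogeneous⁺ (yes (a , refl)) (no u′∉) _ _ _ _ uu′ _ = contradiction uu′ (apart a u′∉)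
    homogeneous⁺ (yes (a , refl)) (yes (a′ , refl)) (yes (b , refl)) (no v′∉) _ _ _ vv′ =
      contradiction vv′ (apart b v′∉)
    homogeneous⁺ (yes (a , refl)) (yes (a′ , refl)) (no v∉) (yes (b′ , refl)) _ _ _ vv′ =
      contradiction (≡.sym vv′) (apart b′ v∉)
    homogeneous⁺ (yes (a , refl)) (yes (a′ , refl)) (no v∉) (no v′∉) _ _ uu′ vv′ =
      cross v∉ v′∉ uu′ vv′
    homogeneous⁺ (yes (a , refl)) (yes (a′ , refl)) (yes (b , refl)) (yes (b′ , refl)) u∈ v∉ uu′ vv′ =
      homogeneous C u∈ v∉ uu′ vv′

    code-inj⁺ : ∀ {y z} (dy : Dec (∃ λ b → ι b ≡ y)) (dz : Dec (∃ λ b → ι b ≡ z)) →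
      inside⁺ dy ≡ true → inside⁺ dz ≡ true →
      extend c₀ (code C) dy ≡ extend c₀ (code C) dz → q y ≡ q z
    code-inj⁺ (yes (a , refl)) (yes (b , refl)) y∈ z∈ eq = code-inj C y∈ z∈ eq

-- In the graph built by the whole expression, two vertices created by the subexpression e
-- are adjacent if e makes them so or if a later join J, depending on their labels in e, does.
AdjacentAfter : ∀ {k m} → Expr k m → (Fin k → Fin k → Bool) → (Fin m → Fin m → Bool) → Set
AdjacentAfter e J α = ∀ x y → α x y ≡ eadj e x y ∨ J (label e x) (label e y)

-- Induction on `e` with `J` general: a join is absorbed into `J`, a relabelling is composed with
-- it. While the children of a union are apart, adjacency across them is `J` of the labels, hence
-- constant between parts, and a cluster of the child containing `x` extends.
cluster : ∀ {k m K α} (e : Expr (suc k) m) J → AdjacentAfter e J α →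
  {q : Fin m → Fin K} → Admissible e q → ∀ x → Cluster α q (suc k + k) x
cluster {k} (vertex i) J α≡ _ = complete-cluster (vertex i) k λ { zero zero _ → refl }
cluster (join i j _ e) J α≡ adm = cluster e
  (λ a b → ((eqb a i ∧ eqb b j) ∨ (eqb a j ∧ eqb b i)) ∨ J a b)
  (λ x y → trans (α≡ x y) (∨-assoc (eadj e x y) _ _)) adm
cluster (relabel i j e) J α≡ (inj₁ adm) =
  cluster e (λ a b → J (relabelled i j a) (relabelled i j b)) α≡ adm
cluster {k} (relabel i j e) J α≡ (inj₂ (c , _)) = complete-cluster e k c
cluster (union e e′) J α≡ (inj₂ (c , c′ , r , _ , _ , ab)) = union-cluster e e′ c c′ r ab
cluster {α = α} (union {m} {m′} e e′) J α≡ {q} (inj₁ (adm , adm′ , apart)) x with side m x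
... | inˡ a = Cluster-extend (_↑ˡ m′) (↑ˡ-injective m′ _ _) apartˡ crossˡ zero
  (cluster e J (λ x y → trans (α≡ _ _)
    (cong₂ _∨_ (eadj-↑ˡ e e′ x y) (cong₂ J (label-↑ˡ e e′ x) (label-↑ˡ e e′ y)))) adm a)
  where
  apartˡ : ∀ a {y} → ¬ (∃ λ b → b ↑ˡ m′ ≡ y) → q (a ↑ˡ m′) ≢ q y
  apartˡ a y∉ with ∉↑ˡ⇒∈↑ʳ y∉
  ... | b , refl = apart a b

  crossˡ : ∀ {a a′ y y′} → ¬ (∃ λ b → b ↑ˡ m′ ≡ y) → ¬ (∃ λ b → b ↑ˡ m′ ≡ y′) →
    q (a ↑ˡ m′) ≡ q (a′ ↑ˡ m′) → q y ≡ q y′ → α (a ↑ˡ m′) y ≡ α (a′ ↑ˡ m′) y′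
  crossˡ {a} {a′} y∉ y′∉ aa′ yy′ with ∉↑ˡ⇒∈↑ʳ y∉ | ∉↑ˡ⇒∈↑ʳ y′∉
  ... | b , refl | b′ , refl = trans (joined a b) (trans
      (cong₂ J (Admissible⇒refines e adm a a′ aa′) (Admissible⇒refines e′ adm′ b b′ yy′))
      (≡.sym (joined a′ b′)))
    where
    joined : ∀ a b → α (a ↑ˡ m′) (m ↑ʳ b) ≡ J (label e a) (label e′ b)
    joined a b = trans (α≡ _ _)
      (cong₂ _∨_ (eadj-↑ˡ-↑ʳ e e′ a b) (cong₂ J (label-↑ˡ e e′ a) (label-↑ʳ e e′ b)))
... | inʳ b = Cluster-extend (m ↑ʳ_) (↑ʳ-injective m _ _) apartʳ crossʳ zero
  (cluster e′ J (λ x y → trans (α≡ _ _)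
    (cong₂ _∨_ (eadj-↑ʳ e e′ x y) (cong₂ J (label-↑ʳ e e′ x) (label-↑ʳ e e′ y)))) adm′ b)
  where
  apartʳ : ∀ b {y} → ¬ (∃ λ a → m ↑ʳ a ≡ y) → q (m ↑ʳ b) ≢ q y
  apartʳ b y∉ with ∉↑ʳ⇒∈↑ˡ y∉
  ... | a , refl = apart a b ∘ ≡.sym

  crossʳ : ∀ {b b′ y y′} → ¬ (∃ λ a → m ↑ʳ a ≡ y) → ¬ (∃ λ a → m ↑ʳ a ≡ y′) →
    q (m ↑ʳ b) ≡ q (m ↑ʳ b′) → q y ≡ q y′ → α (m ↑ʳ b) y ≡ α (m ↑ʳ b′) y′
  crossʳ {b} {b′} y∉ y′∉ bb′ yy′ with ∉↑ʳ⇒∈↑ˡ y∉ | ∉↑ʳ⇒∈↑ˡ y′∉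
  ... | a , refl | a′ , refl = trans (joined b a) (trans
      (cong₂ J (Admissible⇒refines e′ adm′ b b′ bb′) (Admissible⇒refines e adm a a′ yy′))
      (≡.sym (joined b′ a′)))
    where
    joined : ∀ b a → α (m ↑ʳ b) (a ↑ˡ m′) ≡ J (label e′ b) (label e a)
    joined b a = trans (α≡ _ _)
      (cong₂ _∨_ (eadj-↑ʳ-↑ˡ e e′ a b) (cong₂ J (label-↑ʳ e e′ b) (label-↑ˡ e e′ a)))

-- From clusters to the clique-width bound.

module _ (G : Graph) (p : Labelling (n G)) {s : ℕ} where

  -- A red edge leaving the cluster would contradict homogeneity, so a red walk starting inside
  -- stays inside.
  reach-inside : ∀ {x} (C : Cluster (adj G) p s x) {b} → RedReach G p (p x) b →
    ∀ y → p y ≡ b → inside C y ≡ true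
  reach-inside {x} C (here _) y py = trans (saturated C y x py) (x-inside C)
  reach-inside C (step r (_ , u , u′ , v , v′ , pu , pu′ , pv , pv′ , uv , u′v′)) y py
    with inside C v in v∈
  ... | true  = trans (saturated C y v (trans py (≡.sym pv))) v∈
  ... | false with () ← trans (≡.sym uv) (trans
    (homogeneous C (reach-inside C r u pu) v∈ (trans pu (≡.sym pu′)) (trans pv (≡.sym pv′))) u′v′)

  -- Pigeonhole: among `suc s` parts of the component, all inside the cluster, two share a code and
  -- hence coincide.
  cluster⇒bound : ∀ {x} → Cluster (adj G) p s x → (f : Fin (suc s) → Fin (n G)) →
    Injective _≡_ _≡_ f → ¬ (∀ i → RedReach G p (p x) (f i))
  cluster⇒bound C f f-inj reach
    with i , j , i<j , eq ← pigeonhole (ℕ.n<1+n s)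
           -- A vertex of the part at the far end of a red walk is found as the source of the
           -- reversed walk.
           (λ i → code C (proj₁ (RedReach-source G p (RedReach-sym G p (reach i)))))
    with y , py ← RedReach-source G p (RedReach-sym G p (reach i))
       | z , pz ← RedReach-source G p (RedReach-sym G p (reach j)) =
    <-irrefl (f-inj (trans (≡.sym py) (trans
      (code-inj C (reach-inside C (reach i) y py) (reach-inside C (reach j) z pz) eq) pz))) i<j

  clusters⇒components : (∀ x → Cluster (adj G) p s x) → RedComponentsAtMost G p s
  clusters⇒components clusters a f f-inj reach with RedReach-source G p (reach zero)
  ... | x , refl = cluster⇒bound (clusters x) f f-inj reach

cw⇒ctww : (G : Graph) (k : ℕ) → CwAtMost G (suc k) → CtwwAtMost G (suc k + k)
cw⇒ctww G k (e , π , adj≡) =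
  S , λ i → clusters⇒components G (P S i) (λ x → part-cluster i x (stages i))
  where
  open Inverse π using (to; from; strictlyInverseˡ; strictlyInverseʳ)

  -- Second alternative: the label classes of the whole expression are complete, so at most `suc k`
  -- parts remain and any merge is allowed.
  Good : ∀ {K} → (Fin (n G) → Fin K) → Set
  Good q = Admissible e (q ∘ from) ⊎ Complete e (q ∘ from)

  move : ∀ {K} (q : Fin (n G) → Fin (suc (suc K))) → StrictlySurjective _≡_ q → Good q →
    ∃ λ u → ∃ λ v → q u ≢ q v × (∀ {K′} (r : Fin (n G) → Fin K′) → Merged q u v r → Good r)
  move q surj good with [ progress e (q ∘ from) , inj₁ ]′ good
  ... | inj₂ (u , v , u≢v , keeps) =
    from u , from v , u≢v , λ r merged → inj₁ (keeps (r ∘ from) (λ x y → merged (from x) (from y)))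
  -- At least two colours are in use; the classes of the first two are merged.
  ... | inj₁ c with surj zero | surj (suc zero)
  ...   | u , u≡0 | v , v≡1 =
    u , v , (λ eq → contradiction (trans (≡.sym u≡0) (trans eq v≡1)) λ ()) ,
    λ r merged → inj₂ (λ x y → Merged-coarsens merged _ _ ∘ c x y)

  from-injective : Injective _≡_ _≡_ from
  from-injective {x} {y} eq =
    trans (≡.sym (strictlyInverseˡ x)) (trans (cong to eq) (strictlyInverseˡ y))

  greedy = greedy-sequence Good (inj₁ (Admissible-injective e from-injective)) move

  S : PartitionSequence (n G)
  S = proj₁ greedy

  stages = proj₂ greedy

  part-cluster : ∀ i x → (Σ ℕ λ K → Σ (Fin (n G) → Fin K) λ q →
    Good q × q ker⊆ P S i × P S i ker⊆ q) → Cluster (adj G) (P S i) (suc k + k) x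
  part-cluster i x (_ , q , good , q⊆p , p⊆q) = Cluster-map to adj≡
    (λ y z → fill y z ∘ p⊆q y z)
    (λ y z → q⊆p y z ∘ unfill y z)
    -- No join follows the whole expression, so `J` is constantly `false`.
    ([ (λ adm → cluster e (λ _ _ → false) (λ u v → ≡.sym (∨-identityʳ _)) adm (to x))
     , (λ c → complete-cluster e k c (to x)) ]′ good)
    where
    q-from-to : ∀ y → q (from (to y)) ≡ q y
    q-from-to y = cong q (strictlyInverseʳ y)

    fill : ∀ y z → q y ≡ q z → q (from (to y)) ≡ q (from (to z))
    fill y z eq = trans (q-from-to y) (trans eq (≡.sym (q-from-to z)))

    unfill : ∀ y z → q (from (to y)) ≡ q (from (to z)) → q y ≡ q z
    unfill y z eq = trans (≡.sym (q-from-to y)) (trans eq (q-from-to z))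

some-label : ∀ {k m} → Expr k m → Fin k
some-label (vertex i)      = i
some-label (union e _)     = some-label e
some-label (relabel i _ _) = i
some-label (join i _ _ _)  = i

cw⇒stw : (G : Graph) (k : ℕ) → CwAtMost G k → StwAtMost G (2 * (k ∸ 1))
-- Every expression uses a label, so none exists over zero labels.
cw⇒stw G zero    (e , _) with () ← some-label e
-- `(suc k + k) ∸ 1` computes to `k + k`, and `2 * k` to `k + (k + 0)`.
cw⇒stw G (suc k) cw = subst (StwAtMost G) (cong (k +_) (≡.sym (ℕ.+-identityʳ k)))
  (ctww⇒stw G (suc k + k) (cw⇒ctww G k cw))

theorem1 : (G : Graph) →
    (∀ (k : ℕ) → CtwwAtMost G k → StwAtMost G (k ∸ 1)) ×
    (∀ (k : ℕ) → CwAtMost G k → StwAtMost G (2 * (k ∸ 1)))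
theorem1 G = ctww⇒stw G , cw⇒stw G
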